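{- Every $C_4$-free graph $G\neq K_3$ satisfies $\varphi(G)\ge \chi(G)-2$.
   Context: All graphs are finite, simple and non-empty. $C_4$-free means $G$ contains no cycle of length 4 as a (not necessarily induced) subgraph. For a proper colouring $\sigma$ of $G$, $\varphi_\sigma(G)=\max_{H}\big(|\sigma(V(H))|-\chi(H)\big)$ over all induced subgraphs $H$ of $G$; the chromatic discrepancy is $\varphi(G)=\min_\sigma \varphi_\sigma(G)$ over all proper colourings $\sigma$ of $G$. -}

module Defs where

open import Data.Nat using (ℕ; suc; _+_; _≤_; _<_)
open import Data.Nat.Properties using (_≟_)
open import Data.Bool using (Bool; true; false; not; T)
open import Data.Fin using (Fin)
open import Data.Fin.Properties using () renaming (_≟_ to _≟ᶠ_)
open import Data.List using (List; length; map; filter; deduplicate; allFin)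
open import Data.Product using (Σ; ∃; _×_; _,_)
open import Relation.Binary.PropositionalEquality using (_≡_; _≢_)
open import Relation.Nullary using (¬_; Dec; does)
open import Function.Bundles using (_⤖_; Bijection)

record Graph (n : ℕ) : Set where
  field
    adj    : Fin n → Fin n → Bool
    sym    : ∀ u v → adj u v ≡ adj v u
    irrefl : ∀ v → adj v v ≡ false
open Graph public

Iso : ∀ {n m} → Graph n → Graph m → Set
Iso {n} {m} G H = Σ (Fin n ⤖ Fin m) λ f →
  ∀ u v → adj G u v ≡ adj H (Bijection.to f u) (Bijection.to f v)

K3 : Graph 3
K3 = record
  { adj    = λ u v → not (does (u ≟ᶠ v))
  ; sym    = symK
  ; irrefl = irrK
  }
  where
  open import Data.Fin using (zero; suc)
  symK : ∀ (u v : Fin 3) → not (does (u ≟ᶠ v)) ≡ not (does (v ≟ᶠ u))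
  symK zero zero = Relation.Binary.PropositionalEquality.refl
  symK zero (suc zero) = Relation.Binary.PropositionalEquality.refl
  symK zero (suc (suc zero)) = Relation.Binary.PropositionalEquality.refl
  symK (suc zero) zero = Relation.Binary.PropositionalEquality.refl
  symK (suc zero) (suc zero) = Relation.Binary.PropositionalEquality.refl
  symK (suc zero) (suc (suc zero)) = Relation.Binary.PropositionalEquality.refl
  symK (suc (suc zero)) zero = Relation.Binary.PropositionalEquality.refl
  symK (suc (suc zero)) (suc zero) = Relation.Binary.PropositionalEquality.refl
  symK (suc (suc zero)) (suc (suc zero)) = Relation.Binary.PropositionalEquality.refl
  irrK : ∀ (v : Fin 3) → not (does (v ≟ᶠ v)) ≡ false
  irrK zero = Relation.Binary.PropositionalEquality.refl
  irrK (suc zero) = Relation.Binary.PropositionalEquality.refl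
  irrK (suc (suc zero)) = Relation.Binary.PropositionalEquality.refl

HasC4 : ∀ {n} → Graph n → Set
HasC4 {n} G = Σ (Fin n) λ a → Σ (Fin n) λ b → Σ (Fin n) λ c → Σ (Fin n) λ d →
  (a ≢ b) × (a ≢ c) × (a ≢ d) × (b ≢ c) × (b ≢ d) × (c ≢ d) ×
  adj G a b ≡ true × adj G b c ≡ true × adj G c d ≡ true × adj G d a ≡ true

C4Free : ∀ {n} → Graph n → Set
C4Free G = ¬ HasC4 G

VSet : ℕ → Set
VSet n = Fin n → Bool

full : ∀ {n} → VSet n
full _ = true

NonEmpty : ∀ {n} → VSet n → Set
NonEmpty {n} S = ∃ λ (v : Fin n) → S v ≡ true

ColourableOn : ∀ {n} → Graph n → VSet n → ℕ → Set
ColourableOn {n} G S k = Σ (Fin n → Fin k) λ c →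
  ∀ u v → S u ≡ true → S v ≡ true → adj G u v ≡ true → c u ≢ c v

IsChromaticOn : ∀ {n} → Graph n → VSet n → ℕ → Set
IsChromaticOn G S k = ColourableOn G S k × (∀ j → j < k → ¬ ColourableOn G S j)

IsChromatic : ∀ {n} → Graph n → ℕ → Set
IsChromatic G k = IsChromaticOn G full k

-- A proper colouring of G with colours in ℕ (arbitrary colour set).
ProperColouring : ∀ {n} → Graph n → (Fin n → ℕ) → Set
ProperColouring G σ = ∀ u v → adj G u v ≡ true → σ u ≢ σ v

coloursUsed : ∀ {n} → (Fin n → ℕ) → VSet n → ℕ
coloursUsed {n} σ S = length (deduplicate _≟_ (map σ (filter (λ v → T? (S v)) (allFin n))))
  where open import Data.Bool using (T?)

{-# OPTIONS --safe #-}

-- By C₄-freeness N(y) induces a matching and every vertex other than y has at most one neighbour in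
-- N(y), so adding N(y) to a set avoiding y raises its chromatic number by at most one. Let y see the
-- largest number a of colours, and let R be the set of vertices x ≠ y whose colour y does not see.
-- If χ(R) > χ(G) − a, induct on R and add N(y) to the set obtained (if R is a triangle, N(y) ∪ R is
-- even 3-colourable). Otherwise the colours seen by y together with an optimal colouring of R give an
-- optimal colouring of G; if χ(R) ≥ 2, some vertex of R sees every other colour class, hence more
-- than a colours of σ, contradicting maximality. If χ(R) = 1, add one vertex of R to N(y). If R is
-- empty and σ uses χ(G) colours, every colour class has a vertex z seeing all other colours: a second
-- vertex in its class can be added to N(z), and if there is none G is a clique without C₄.
module Submission where

open import Defs
open import Data.Nat using (ℕ; zero; suc; _+_; _≤_; _<_; z≤n; s≤s)
open import Data.Nat.Properties
  using (_≟_; _<?_; ≤-refl; ≤-trans; ≤-reflexive; ≤-pred; ≰⇒>; <-irrefl; <-asym; <-cmp; n≤1+n; m≤m+n;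
         m≤n⇒∃[o]m+o≡n; +-suc; +-comm; +-assoc; +-monoʳ-≤; +-monoˡ-≤; module ≤-Reasoning)
open import Data.Bool using (true; false; T?)
import Data.Bool.Properties as Bool
open import Data.Fin using (Fin; zero; suc; toℕ; inject≤; _↑ˡ_; _↑ʳ_; splitAt; fromℕ<)
open import Data.Fin.Properties
  using (any?; all?; ¬∀⟶∃¬; injective⇒≤; inject≤-injective; suc-injective; toℕ-injective;
         ↑ˡ-injective; ↑ʳ-injective; splitAt-↑ˡ; splitAt-↑ʳ)
  renaming (_≟_ to _≟ᶠ_)
open import Data.Vec.Functional using () renaming ([] to []ᶠ; _∷_ to _∷ᶠ_)
open import Data.List using (List; []; _∷_; _++_; length; lookup; map; filter; allFin; deduplicate)
open import Data.List.Properties using (length-++)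
open import Data.List.Extrema.Nat using (argmax; argmax-all; f[xs]≤f[argmax])
open import Data.List.Membership.Propositional using (_∈_; _∉_)
open import Data.List.Membership.DecPropositional _≟_ using (_∈?_)
open import Data.List.Membership.Propositional.Properties
  using (∈-deduplicate⁺; ∈-deduplicate⁻; ∈-map∘filter⁺; ∈-map∘filter⁻; ∈-filter⁺; ∈-filter⁻;
         ∈-allFin; ∈-lookup; ∈-++⁻)
open import Data.List.Relation.Unary.All as All using (All; []; _∷_)
open import Data.List.Relation.Unary.Any using (here; there; index)
open import Data.List.Relation.Unary.Any.Properties using (lookup-index)
open import Data.List.Relation.Unary.AllPairs using ([]; _∷_)
open import Data.List.Relation.Unary.Unique.Propositional using (Unique)
open import Data.List.Relation.Unary.Unique.Propositional.Properties using () renaming (++⁺ to unique-++⁺)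
open import Data.List.Relation.Unary.Unique.DecPropositional.Properties _≟_ using (deduplicate-!)
open import Data.Product using (Σ; ∃; _×_; _,_; proj₁; proj₂)
open import Data.Sum using (_⊎_; inj₁; inj₂)
open import Data.Empty using (⊥; ⊥-elim)
open import Function using (_∘_)
open import Function.Bundles using (mk⤖; Equivalence)
open import Relation.Nullary using (¬_; Dec; yes; no; does; contradiction)
open import Relation.Nullary.Decidable using (dec-true; decidable-stable; map′; ¬?; _×-dec_; _⊎-dec_; _→-dec_)
open import Relation.Binary.Definitions using (tri<; tri≈; tri>)
open import Relation.Binary.PropositionalEquality
  using (_≡_; _≢_; refl; trans; cong; subst; ≢-sym) renaming (sym to ≡-sym)

-- Repetition-free lists and finite search.

lookup-injective : ∀ {A : Set} {xs : List A} → Unique xs →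
  ∀ {i j} → lookup xs i ≡ lookup xs j → i ≡ j
lookup-injective {xs = _ ∷ _} _        {zero}  {zero}  _  = refl
lookup-injective {xs = _ ∷ _} (x∉ ∷ _) {zero}  {suc j} eq = contradiction eq (All.lookup x∉ (∈-lookup j))
lookup-injective {xs = _ ∷ _} (x∉ ∷ _) {suc i} {zero}  eq = contradiction (≡-sym eq) (All.lookup x∉ (∈-lookup i))
lookup-injective {xs = _ ∷ _} (_ ∷ u)  {suc i} {suc j} eq = cong suc (lookup-injective u eq)

index-injective : ∀ {A : Set} {xs : List A} {x y : A} (p : x ∈ xs) (q : y ∈ xs) →
  index p ≡ index q → x ≡ y
index-injective {xs = xs} p q eq =
  trans (lookup-index p) (trans (cong (lookup xs) eq) (≡-sym (lookup-index q)))

unique-⊆⇒length≤ : ∀ {A : Set} {xs ys : List A} → Unique xs →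
  (∀ {x} → x ∈ xs → x ∈ ys) → length xs ≤ length ys
unique-⊆⇒length≤ u sub = injective⇒≤ {f = λ i → index (sub (∈-lookup i))}
  λ eq → lookup-injective u (index-injective (sub (∈-lookup _)) (sub (∈-lookup _)) eq)

∉⇒unique-∷ : ∀ {A : Set} {x : A} {xs} → x ∉ xs → Unique xs → Unique (x ∷ xs)
∉⇒unique-∷ x∉ u = All.tabulate (λ y∈ x≡y → x∉ (subst (_∈ _) (≡-sym x≡y) y∈)) ∷ u

-- The search fixes one value at a time. A function and its rebuilding from head and tail agree only
-- pointwise, hence the hypothesis that `P` respects pointwise equality.
any-function? : ∀ {k} n {P : (Fin n → Fin k) → Set} →
  (∀ {f g} → (∀ i → f i ≡ g i) → P f → P g) → (∀ f → Dec (P f)) → Dec (∃ P)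
any-function? zero    resp P? = map′ ([]ᶠ ,_) (λ { (f , p) → resp {f} (λ ()) p }) (P? []ᶠ)
any-function? (suc n) resp P? = map′
  (λ { (i , f , p) → (i ∷ᶠ f) , p })
  (λ { (f , p) → f zero , f ∘ suc , resp (λ { zero → refl ; (suc i) → refl }) p })
  (any? λ i → any-function? n (λ f≗g → resp λ { zero → refl ; (suc j) → f≗g j }) (λ f → P? (i ∷ᶠ f)))

-- Sets of vertices.

infix 4 _∈ᵥ_
_∈ᵥ_ : ∀ {n} → Fin n → VSet n → Set
v ∈ᵥ S = S v ≡ true

_∈ᵥ?_ : ∀ {n} (v : Fin n) (S : VSet n) → Dec (v ∈ᵥ S)
v ∈ᵥ? S = S v Bool.≟ true

-- Sets are kept abstract so that they can be inferred from membership proofs.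
abstract
  ⟪_⟫ : ∀ {n} {P : Fin n → Set} → (∀ v → Dec (P v)) → VSet n
  ⟪ P? ⟫ v = does (P? v)

  ∈⟪⟫⁺ : ∀ {n} {P : Fin n → Set} (P? : ∀ v → Dec (P v)) {v} → P v → v ∈ᵥ ⟪ P? ⟫
  ∈⟪⟫⁺ P? {v} = dec-true (P? v)

  ∈⟪⟫⁻ : ∀ {n} {P : Fin n → Set} (P? : ∀ v → Dec (P v)) {v} → v ∈ᵥ ⟪ P? ⟫ → P v
  ∈⟪⟫⁻ P? {v} v∈ with P? v
  ... | yes p = p

  infixr 6 _∪_
  _∪_ : ∀ {n} → VSet n → VSet n → VSet n
  S ∪ S′ = ⟪ (λ v → v ∈ᵥ? S ⊎-dec v ∈ᵥ? S′) ⟫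

  ∈∪⁺ : ∀ {n} {S S′ : VSet n} {v} → v ∈ᵥ S ⊎ v ∈ᵥ S′ → v ∈ᵥ S ∪ S′
  ∈∪⁺ {S = S} {S′} = ∈⟪⟫⁺ (λ v → v ∈ᵥ? S ⊎-dec v ∈ᵥ? S′)

  ∈∪⁻ : ∀ {n} {S S′ : VSet n} {v} → v ∈ᵥ S ∪ S′ → v ∈ᵥ S ⊎ v ∈ᵥ S′
  ∈∪⁻ {S = S} {S′} = ∈⟪⟫⁻ (λ v → v ∈ᵥ? S ⊎-dec v ∈ᵥ? S′)

  singleton : ∀ {n} → Fin n → VSet n
  singleton x = ⟪ _≟ᶠ x ⟫

  ∈singleton⁺ : ∀ {n} {x : Fin n} → x ∈ᵥ singleton x
  ∈singleton⁺ {x = x} = ∈⟪⟫⁺ (_≟ᶠ x) refl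

  ∈singleton⁻ : ∀ {n} {x v : Fin n} → v ∈ᵥ singleton x → v ≡ x
  ∈singleton⁻ {x = x} = ∈⟪⟫⁻ (_≟ᶠ x)

-- Colours occurring on a set of vertices.

module Palette {n : ℕ} (σ : Fin n → ℕ) where

  -- Repeats the list inside `coloursUsed`, so that `coloursUsed σ S` is `length (palette S)` by
  -- definition.
  palette : VSet n → List ℕ
  palette S = deduplicate _≟_ (map σ (filter (λ v → T? (S v)) (allFin n)))

  palette-unique : ∀ S → Unique (palette S)
  palette-unique S = deduplicate-! (map σ (filter (λ v → T? (S v)) (allFin n)))

  ∈palette⁺ : ∀ {S v} → v ∈ᵥ S → σ v ∈ palette S
  ∈palette⁺ {S} {v} v∈ = ∈-deduplicate⁺ _≟_
    (∈-map∘filter⁺ σ (λ v → T? (S v)) (v , ∈-allFin v , refl , Equivalence.from Bool.T-≡ v∈))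

  ∈palette⁻ : ∀ {S c} → c ∈ palette S → ∃ λ v → v ∈ᵥ S × c ≡ σ v
  ∈palette⁻ {S} c∈
    with v , _ , eq , t ← ∈-map∘filter⁻ σ (λ v → T? (S v)) {xs = allFin n}
           (∈-deduplicate⁻ _≟_ (map σ (filter (λ v → T? (S v)) (allFin n))) c∈)
    = v , Equivalence.to Bool.T-≡ t , eq

  ∈palette-mono : ∀ {S S′ c} → (∀ {v} → v ∈ᵥ S → v ∈ᵥ S′) → c ∈ palette S → c ∈ palette S′
  ∈palette-mono sub c∈ with v , v∈ , refl ← ∈palette⁻ c∈ = ∈palette⁺ (sub v∈)

  unique⇒length≤coloursUsed : ∀ {S xs} → Unique xs → (∀ {c} → c ∈ xs → c ∈ palette S) →
    length xs ≤ coloursUsed σ S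
  unique⇒length≤coloursUsed = unique-⊆⇒length≤

  coloursUsed-∪ : ∀ S S′ → (∀ {v} → v ∈ᵥ S′ → σ v ∉ palette S) →
    coloursUsed σ S + coloursUsed σ S′ ≤ coloursUsed σ (S ∪ S′)
  coloursUsed-∪ S S′ disjoint = ≤-trans
    (≤-reflexive (≡-sym (length-++ (palette S))))
    (unique⇒length≤coloursUsed {S = S ∪ S′}
      (unique-++⁺ (palette-unique S) (palette-unique S′) disjoint′) sub)
    where
    disjoint′ : ∀ {c} → c ∈ palette S × c ∈ palette S′ → ⊥
    disjoint′ (c∈S , c∈S′) with v , v∈ , refl ← ∈palette⁻ c∈S′ = disjoint v∈ c∈S

    sub : ∀ {c} → c ∈ palette S ++ palette S′ → c ∈ palette (S ∪ S′)
    sub c∈ with ∈-++⁻ (palette S) c∈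
    ... | inj₁ c∈S  = ∈palette-mono (λ v∈ → ∈∪⁺ (inj₁ v∈)) c∈S
    ... | inj₂ c∈S′ = ∈palette-mono (λ v∈ → ∈∪⁺ (inj₂ v∈)) c∈S′

  NonEmpty⇒1≤coloursUsed : ∀ {S} → NonEmpty S → 1 ≤ coloursUsed σ S
  NonEmpty⇒1≤coloursUsed {S} (v , v∈) = unique⇒length≤coloursUsed {S = S} ([] ∷ [])
    λ { (here refl) → ∈palette⁺ v∈ }

-- Colourings of induced subgraphs.

module Colouring {n : ℕ} (G : Graph n) where

  infix 4 _~_
  _~_ : Fin n → Fin n → Set
  u ~ v = adj G u v ≡ true

  _~?_ : ∀ u v → Dec (u ~ v)
  u ~? v = adj G u v Bool.≟ true

  ~-sym : ∀ {u v} → u ~ v → v ~ u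
  ~-sym {u} {v} = trans (sym G v u)

  ~⇒≢ : ∀ {u v} → u ~ v → u ≢ v
  ~⇒≢ {u} e refl with () ← trans (≡-sym e) (irrefl G u)

  colourable? : ∀ S k → Dec (ColourableOn G S k)
  colourable? S k = any-function? n
    (λ f≗g proper u v u∈ v∈ e eq → proper u v u∈ v∈ e (trans (f≗g u) (trans eq (≡-sym (f≗g v)))))
    (λ c → all? λ u → all? λ v →
      u ∈ᵥ? S →-dec (v ∈ᵥ? S →-dec (u ~? v →-dec ¬? (c u ≟ᶠ c v))))

  colourable-mono : ∀ {S j k} → j ≤ k → ColourableOn G S j → ColourableOn G S k
  colourable-mono j≤k (c , proper) =
    (λ v → inject≤ (c v) j≤k) ,
    λ u v u∈ v∈ e eq → proper u v u∈ v∈ e (inject≤-injective j≤k j≤k _ _ eq)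

  colourable-⊆ : ∀ {S S′ k} → (∀ {v} → v ∈ᵥ S → v ∈ᵥ S′) → ColourableOn G S′ k → ColourableOn G S k
  colourable-⊆ sub (c , proper) = c , λ u v u∈ v∈ → proper u v (sub u∈) (sub v∈)

  -- The constructions below only bound χ(S) from above. Descending one colour at a time reaches the
  -- exact value, since by `colourable-mono` a failure at `h` excludes every smaller number.
  chromatic-≤ : ∀ S h → ColourableOn G S h → Σ ℕ λ h′ → IsChromaticOn G S h′ × h′ ≤ h
  chromatic-≤ S zero    col = zero , (col , λ _ ()) , z≤n
  chromatic-≤ S (suc h) col with colourable? S h
  ... | yes col′ with h′ , chr , h′≤h ← chromatic-≤ S h col′ = h′ , chr , ≤-trans h′≤h (n≤1+n h)
  ... | no ¬col  = suc h , (col , λ j j<1+h colⱼ → ¬col (colourable-mono (≤-pred j<1+h) colⱼ)) , ≤-refl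

  -- Otherwise giving each vertex of X a colour it does not see would m-colour T.
  saturatedVertex : ∀ (T X : VSet n) m (κ : Fin n → Fin m) →
    (∀ u v → u ∈ᵥ T → v ∈ᵥ T → ¬ u ∈ᵥ X → ¬ v ∈ᵥ X → u ~ v → κ u ≢ κ v) →
    (∀ u v → u ∈ᵥ X → v ∈ᵥ X → ¬ u ~ v) →
    ¬ ColourableOn G T m →
    ∃ λ z → z ∈ᵥ T × z ∈ᵥ X × (∀ i → ∃ λ v → v ∈ᵥ T × ¬ v ∈ᵥ X × z ~ v × κ v ≡ i)
  saturatedVertex T X m κ proper independent ¬col
    with any? (λ z → z ∈ᵥ? T ×-dec (z ∈ᵥ? X ×-dec all? (λ i →
           any? λ v → v ∈ᵥ? T ×-dec (¬? (v ∈ᵥ? X) ×-dec (z ~? v ×-dec κ v ≟ᶠ i)))))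
  ... | yes found = found
  ... | no none   = ⊥-elim (¬col (κ′ , proper′))
    where
    Sees : Fin n → Fin m → Set
    Sees z i = ∃ λ v → v ∈ᵥ T × ¬ v ∈ᵥ X × z ~ v × κ v ≡ i

    sees? : ∀ z i → Dec (Sees z i)
    sees? z i = any? λ v → v ∈ᵥ? T ×-dec (¬? (v ∈ᵥ? X) ×-dec (z ~? v ×-dec κ v ≟ᶠ i))

    free : ∀ z → Dec (∃ λ i → ¬ Sees z i) → Fin m
    free z (yes (i , _)) = i
    -- A default: `none` rules this case out for vertices of `T` in `X`, and outside `T` any value
    -- will do.
    free z (no _)        = κ z

    free-unseen : ∀ z → z ∈ᵥ T → z ∈ᵥ X → (d : Dec (∃ λ i → ¬ Sees z i)) → ¬ Sees z (free z d)
    free-unseen z z∈T z∈X (yes (_ , ¬s)) = ¬s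
    free-unseen z z∈T z∈X (no all-seen)  _ =
      all-seen (¬∀⟶∃¬ m (Sees z) (sees? z) λ s → none (z , z∈T , z∈X , s))

    free? : ∀ z → Dec (∃ λ i → ¬ Sees z i)
    free? z = any? λ i → ¬? (sees? z i)

    recolour : ∀ v → Dec (v ∈ᵥ X) → Fin m
    recolour v (yes _) = free v (free? v)
    recolour v (no _)  = κ v

    κ′ : Fin n → Fin m
    κ′ v = recolour v (v ∈ᵥ? X)

    proper′ : ∀ u v → u ∈ᵥ T → v ∈ᵥ T → u ~ v → κ′ u ≢ κ′ v
    proper′ u v u∈ v∈ e with u ∈ᵥ? X | v ∈ᵥ? X
    ... | yes u∈X | yes v∈X = λ _ → independent u v u∈X v∈X e
    ... | yes u∈X | no v∉X  = λ eq → free-unseen u u∈ u∈X (free? u) (v , v∈ , v∉X , e , ≡-sym eq)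
    ... | no u∉X  | yes v∈X = λ eq → free-unseen v v∈ v∈X (free? v) (u , u∈ , u∉X , ~-sym e , eq)
    ... | no u∉X  | no v∉X  = proper u v u∈ v∈ u∉X v∉X e

  -- The exception in the induction: every subset of such a `T` has as many colours under a proper
  -- colouring as its chromatic number, so for m = 2 no subset meets the bound of `Discrepant`.
  record Triangle (T : VSet n) : Set where
    field
      {x₀ x₁ x₂} : Fin n
      x₀∈ : x₀ ∈ᵥ T
      x₁∈ : x₁ ∈ᵥ T
      x₂∈ : x₂ ∈ᵥ T
      x₀~x₁ : x₀ ~ x₁
      x₁~x₂ : x₁ ~ x₂
      x₀~x₂ : x₀ ~ x₂
      exhaustive : ∀ {v} → v ∈ᵥ T → v ≡ x₀ ⊎ v ≡ x₁ ⊎ v ≡ x₂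

  abstract
    N : VSet n → Fin n → VSet n
    N T y = ⟪ (λ v → v ∈ᵥ? T ×-dec y ~? v) ⟫

    ∈N⁺ : ∀ {T y v} → v ∈ᵥ T → y ~ v → v ∈ᵥ N T y
    ∈N⁺ {T} {y} v∈ e = ∈⟪⟫⁺ (λ v → v ∈ᵥ? T ×-dec y ~? v) (v∈ , e)

    ∈N⁻ : ∀ {T y v} → v ∈ᵥ N T y → v ∈ᵥ T × y ~ v
    ∈N⁻ {T} {y} = ∈⟪⟫⁻ (λ v → v ∈ᵥ? T ×-dec y ~? v)

-- Neighbourhoods in a C₄-free graph.

module Neighbourhood {n : ℕ} (G : Graph n) (c4-free : C4Free G) where
  open Colouring G

  -- Otherwise u, p, v, q is a 4-cycle. Every use of C₄-freeness goes through this lemma.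
  commonNbr-unique : ∀ {u v p q} → u ≢ v → u ~ p → v ~ p → u ~ q → v ~ q → p ≡ q
  commonNbr-unique {u} {v} {p} {q} u≢v up vp uq vq with p ≟ᶠ q
  ... | yes p≡q = p≡q
  ... | no p≢q  = ⊥-elim (c4-free (u , p , v , q , ~⇒≢ up , u≢v , ~⇒≢ uq , ≢-sym (~⇒≢ vp) , p≢q , ~⇒≢ vq ,
                                   up , ~-sym vp , vq , ~-sym uq))

  -- By C₄-freeness N(y) induces a matching; Upper marks the larger end of each matching edge.
  module Matching (T : VSet n) (y : Fin n) where

    Upper : Fin n → Set
    Upper p = ∃ λ q → q ∈ᵥ N T y × q ~ p × toℕ q < toℕ p

    upper? : ∀ p → Dec (Upper p)
    upper? p = any? λ q → q ∈ᵥ? N T y ×-dec (q ~? p ×-dec toℕ q <? toℕ p)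

    -- Both `q` and `r` are common neighbours of `y` and `p`.
    mate-unique : ∀ {p q r} → p ∈ᵥ N T y → q ∈ᵥ N T y → r ∈ᵥ N T y → q ~ p → r ~ p → q ≡ r
    mate-unique p∈ q∈ r∈ qp rp =
      commonNbr-unique (~⇒≢ (proj₂ (∈N⁻ p∈))) (proj₂ (∈N⁻ q∈)) (~-sym qp) (proj₂ (∈N⁻ r∈)) (~-sym rp)

    ¬both-upper : ∀ {p q} → p ∈ᵥ N T y → q ∈ᵥ N T y → p ~ q → Upper p → ¬ Upper q
    ¬both-upper p∈ q∈ pq (r , r∈ , rp , r<p) (s , s∈ , sq , s<q)
      with refl ← mate-unique p∈ q∈ r∈ (~-sym pq) rp
         | refl ← mate-unique q∈ p∈ s∈ pq sq
      = <-asym r<p s<q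

    ¬both-lower : ∀ {p q} → p ∈ᵥ N T y → q ∈ᵥ N T y → p ~ q → ¬ Upper p → ¬ ¬ Upper q
    ¬both-lower {p} {q} p∈ q∈ pq ¬p ¬q with <-cmp (toℕ p) (toℕ q)
    ... | tri< p<q _ _ = ¬q (p , p∈ , pq , p<q)
    ... | tri≈ _ p≡q _ = ~⇒≢ pq (toℕ-injective p≡q)
    ... | tri> _ _ q<p = ¬p (q , q∈ , ~-sym pq , q<p)

    -- Lower ends of the matching get the new colour and upper ends the colour 0 of S; a vertex of S
    -- has at most one neighbour in N(y), so those in conflict can move to the new colour.
    N∪-colourable : ∀ {S h} → ¬ y ∈ᵥ S → ColourableOn G S (suc h) → ColourableOn G (N T y ∪ S) (suc (suc h))
    N∪-colourable {S} {h} y∉S (c , proper) = κ , λ u v u∈ v∈ e eq → clash (view u u∈) (view v v∈) e eq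
      where
      Touched : Fin n → Set
      Touched v = ∃ λ p → p ∈ᵥ N T y × Upper p × p ~ v

      touched? : ∀ v → Dec (Touched v)
      touched? v = any? λ p → p ∈ᵥ? N T y ×-dec (upper? p ×-dec p ~? v)

      -- `zero` is the new colour; except at moved vertices, colour `i` of `S` becomes `suc i`.
      paint : ∀ {v} → Dec (v ∈ᵥ N T y) → Dec (Upper v) → Fin (suc h) → Dec (Touched v) → Fin (suc (suc h))
      paint (yes _) (no _)  _       _       = zero
      paint (yes _) (yes _) _       _       = suc zero
      paint (no _)  _       zero    (yes _) = zero
      paint (no _)  _       zero    (no _)  = suc zero
      paint (no _)  _       (suc i) _       = suc (suc i)

      κ : Fin n → Fin (suc (suc h))
      κ v = paint (v ∈ᵥ? N T y) (upper? v) (c v) (touched? v)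

      data View (v : Fin n) (i : Fin (suc (suc h))) : Set where
        lower : v ∈ᵥ N T y → ¬ Upper v → i ≡ zero → View v i
        upper : v ∈ᵥ N T y → Upper v → i ≡ suc zero → View v i
        moved : v ∈ᵥ S → c v ≡ zero → Touched v → i ≡ zero → View v i
        kept  : v ∈ᵥ S → (c v ≡ zero → ¬ Touched v) → i ≡ suc (c v) → View v i

      view : ∀ v → v ∈ᵥ (N T y ∪ S) → View v (κ v)
      view v v∈ with v ∈ᵥ? N T y | ∈∪⁻ v∈ | upper? v | c v in cv | touched? v
      ... | yes v∈N | _        | no ¬u | _     | _      = lower v∈N ¬u refl
      ... | yes v∈N | _        | yes u | _     | _      = upper v∈N u refl
      ... | no v∉N  | inj₁ v∈N | _     | _     | _      = contradiction v∈N v∉N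
      ... | no _    | inj₂ v∈S | _     | zero  | yes t  = moved v∈S cv t refl
      ... | no _    | inj₂ v∈S | _     | zero  | no ¬t  = kept v∈S (λ _ → ¬t) (cong suc (≡-sym cv))
      ... | no _    | inj₂ v∈S | _     | suc i | _      =
        kept v∈S (λ cv≡0 _ → contradiction (trans (≡-sym cv) cv≡0) λ ()) (cong suc (≡-sym cv))

      -- If `p` were adjacent to `v`, then `p` and the upper end `q` touching `v` would both be
      -- common neighbours of `y` and `v`, hence equal. Here `y` and `v` differ because `y` is
      -- outside `S`.
      lower-moved : ∀ {p v} → p ∈ᵥ N T y → ¬ Upper p → v ∈ᵥ S → Touched v → ¬ p ~ v
      lower-moved p∈ ¬u v∈S (q , q∈ , u , qv) pv = ¬u (subst Upper
        (commonNbr-unique (λ { refl → y∉S v∈S }) (proj₂ (∈N⁻ q∈)) (~-sym qv) (proj₂ (∈N⁻ p∈)) (~-sym pv)) u)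

      clash : ∀ {u v i j} → View u i → View v j → u ~ v → i ≢ j
      clash (lower u∈ ¬u refl) (lower v∈ ¬v refl)  e _ = ¬both-lower u∈ v∈ e ¬u ¬v
      clash (lower u∈ ¬u refl) (moved v∈ _ t refl) e _ = lower-moved u∈ ¬u v∈ t e
      clash (moved u∈ _ t refl) (lower v∈ ¬v refl) e _ = lower-moved v∈ ¬v u∈ t (~-sym e)
      clash (moved u∈ cu _ refl) (moved v∈ cv _ refl) e _ = proper _ _ u∈ v∈ e (trans cu (≡-sym cv))
      clash (upper u∈ uu refl) (upper v∈ uv refl) e _ = ¬both-upper u∈ v∈ e uu uv
      clash (upper u∈ uu refl) (kept v∈ ¬t refl) e eq = ¬t (≡-sym (suc-injective eq)) (_ , u∈ , uu , e)
      clash (kept u∈ ¬t refl) (upper v∈ uv refl) e eq = ¬t (suc-injective eq) (_ , v∈ , uv , ~-sym e)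
      clash (kept u∈ _ refl) (kept v∈ _ refl) e eq = proper _ _ u∈ v∈ e (suc-injective eq)
      clash (lower _ _ refl) (upper _ _ refl) _ ()
      clash (lower _ _ refl) (kept _ _ refl) _ ()
      clash (upper _ _ refl) (lower _ _ refl) _ ()
      clash (upper _ _ refl) (moved _ _ _ refl) _ ()
      clash (moved _ _ _ refl) (upper _ _ refl) _ ()
      clash (moved _ _ _ refl) (kept _ _ refl) _ ()
      clash (kept _ _ refl) (lower _ _ refl) _ ()
      clash (kept _ _ refl) (moved _ _ _ refl) _ ()

    -- The corners `x₀`, `x₁`, `x₂` get colours 0, 1, 2, lower ends of the matching get 0 and upper
    -- ends 2. A lower end adjacent to `x₀` or an upper end adjacent to `x₂` moves to colour 1.
    N∪triangle-colourable : ∀ {S} → (∀ {v} → v ∈ᵥ S → ¬ v ∈ᵥ N T y) → Triangle S → ColourableOn G (N T y ∪ S) 3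
    N∪triangle-colourable {S} disjoint tri = κ , λ u v u∈ v∈ e eq → clash (view u u∈) (view v v∈) e eq
      where
      open Triangle tri

      paint : ∀ {v} → Dec (v ≡ x₀) → Dec (v ≡ x₁) → Dec (v ≡ x₂) → Dec (Upper v) → Dec (v ~ x₀) → Dec (v ~ x₂) → Fin 3
      paint (yes _) _       _       _       _       _       = zero
      paint (no _)  (yes _) _       _       _       _       = suc zero
      paint (no _)  (no _)  (yes _) _       _       _       = suc (suc zero)
      paint (no _)  (no _)  (no _)  (no _)  (no _)  _       = zero
      paint (no _)  (no _)  (no _)  (no _)  (yes _) _       = suc zero
      paint (no _)  (no _)  (no _)  (yes _) _       (no _)  = suc (suc zero)
      paint (no _)  (no _)  (no _)  (yes _) _       (yes _) = suc zero

      κ : Fin n → Fin 3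
      κ v = paint (v ≟ᶠ x₀) (v ≟ᶠ x₁) (v ≟ᶠ x₂) (upper? v) (v ~? x₀) (v ~? x₂)

      data View (v : Fin n) : Fin 3 → Set where
        is-x₀       : v ≡ x₀ → View v zero
        is-x₁       : v ≡ x₁ → View v (suc zero)
        is-x₂       : v ≡ x₂ → View v (suc (suc zero))
        lower-free  : v ∈ᵥ N T y → ¬ Upper v → ¬ v ~ x₀ → View v zero
        lower-moved : v ∈ᵥ N T y → ¬ Upper v → v ~ x₀ → View v (suc zero)
        upper-free  : v ∈ᵥ N T y → Upper v → ¬ v ~ x₂ → View v (suc (suc zero))
        upper-moved : v ∈ᵥ N T y → Upper v → v ~ x₂ → View v (suc zero)

      in-N : ∀ {v} → v ∈ᵥ (N T y ∪ S) → v ≢ x₀ → v ≢ x₁ → v ≢ x₂ → v ∈ᵥ N T y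
      in-N v∈ ≢x₀ ≢x₁ ≢x₂ with ∈∪⁻ v∈
      ... | inj₁ v∈N = v∈N
      ... | inj₂ v∈S with exhaustive v∈S
      ...   | inj₁ v≡x₀        = contradiction v≡x₀ ≢x₀
      ...   | inj₂ (inj₁ v≡x₁) = contradiction v≡x₁ ≢x₁
      ...   | inj₂ (inj₂ v≡x₂) = contradiction v≡x₂ ≢x₂

      view : ∀ v → v ∈ᵥ (N T y ∪ S) → View v (κ v)
      view v v∈ with v ≟ᶠ x₀ | v ≟ᶠ x₁ | v ≟ᶠ x₂ | upper? v | v ~? x₀ | v ~? x₂
      ... | yes p | _     | _     | _     | _     | _     = is-x₀ p
      ... | no _  | yes p | _     | _     | _     | _     = is-x₁ p
      ... | no _  | no _  | yes p | _     | _     | _     = is-x₂ p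
      ... | no p  | no q  | no r  | no ¬u | no ¬e | _     = lower-free (in-N v∈ p q r) ¬u ¬e
      ... | no p  | no q  | no r  | no ¬u | yes e | _     = lower-moved (in-N v∈ p q r) ¬u e
      ... | no p  | no q  | no r  | yes u | _     | no ¬e = upper-free (in-N v∈ p q r) u ¬e
      ... | no p  | no q  | no r  | yes u | _     | yes e = upper-moved (in-N v∈ p q r) u e

      -- `x` and `x′` already have the common neighbour `x″`, so `v` would be `x″`. Hence moved ends
      -- are not adjacent to `x₁`.
      ¬twice : ∀ {v x x′ x″} → v ∈ᵥ N T y → x″ ∈ᵥ S → x ~ x′ → x″ ~ x → x″ ~ x′ → v ~ x → ¬ v ~ x′
      ¬twice v∈N x″∈S e e₁ e₂ vx vx′
        with refl ← commonNbr-unique (~⇒≢ e) (~-sym vx) (~-sym vx′) (~-sym e₁) (~-sym e₂) = disjoint x″∈S v∈N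

      x₁-lower : ∀ {v} → v ∈ᵥ N T y → v ~ x₀ → ¬ v ~ x₁
      x₁-lower v∈N = ¬twice v∈N x₂∈ x₀~x₁ (~-sym x₀~x₂) (~-sym x₁~x₂)

      x₁-upper : ∀ {v} → v ∈ᵥ N T y → v ~ x₂ → ¬ v ~ x₁
      x₁-upper v∈N vx₂ vx₁ = ¬twice v∈N x₀∈ x₁~x₂ x₀~x₁ x₀~x₂ vx₁ vx₂

      -- Otherwise `u` and `x₂` are both common neighbours of `x₀` and `v`.
      lower-upper : ∀ {u v} → u ∈ᵥ N T y → v ∈ᵥ N T y → u ~ x₀ → v ~ x₂ → ¬ u ~ v
      lower-upper u∈ v∈ ux₀ vx₂ uv
        with refl ← commonNbr-unique (λ { refl → disjoint x₀∈ v∈ }) (~-sym ux₀) (~-sym uv) x₀~x₂ vx₂ = disjoint x₂∈ u∈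

      clash : ∀ {u v i j} → View u i → View v j → u ~ v → i ≢ j
      clash (is-x₀ refl) (is-x₀ refl) e _ = ~⇒≢ e refl
      clash (is-x₀ refl) (lower-free _ _ ¬e) e _ = ¬e (~-sym e)
      clash (lower-free _ _ ¬e) (is-x₀ refl) e _ = ¬e e
      clash (lower-free u∈ ¬u _) (lower-free v∈ ¬v _) e _ = ¬both-lower u∈ v∈ e ¬u ¬v
      clash (is-x₂ refl) (is-x₂ refl) e _ = ~⇒≢ e refl
      clash (is-x₂ refl) (upper-free _ _ ¬e) e _ = ¬e (~-sym e)
      clash (upper-free _ _ ¬e) (is-x₂ refl) e _ = ¬e e
      clash (upper-free u∈ u _) (upper-free v∈ v _) e _ = ¬both-upper u∈ v∈ e u v
      clash (is-x₁ refl) (is-x₁ refl) e _ = ~⇒≢ e refl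
      clash (is-x₁ refl) (lower-moved v∈ _ vx₀) e _ = x₁-lower v∈ vx₀ (~-sym e)
      clash (is-x₁ refl) (upper-moved v∈ _ vx₂) e _ = x₁-upper v∈ vx₂ (~-sym e)
      clash (lower-moved u∈ _ ux₀) (is-x₁ refl) e _ = x₁-lower u∈ ux₀ e
      clash (upper-moved u∈ _ ux₂) (is-x₁ refl) e _ = x₁-upper u∈ ux₂ e
      clash (lower-moved u∈ ¬u _) (lower-moved v∈ ¬v _) e _ = ¬both-lower u∈ v∈ e ¬u ¬v
      clash (upper-moved u∈ u _) (upper-moved v∈ v _) e _ = ¬both-upper u∈ v∈ e u v
      clash (lower-moved u∈ _ ux₀) (upper-moved v∈ _ vx₂) e _ = lower-upper u∈ v∈ ux₀ vx₂ e
      clash (upper-moved u∈ _ ux₂) (lower-moved v∈ _ vx₀) e _ = lower-upper v∈ u∈ vx₀ ux₂ (~-sym e)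

-- Sets of large discrepancy built around a neighbourhood.

module Discrepancy {n : ℕ} (G : Graph n) (c4-free : C4Free G)
                   (σ : Fin n → ℕ) (σ-proper : ProperColouring G σ) where
  open Colouring G
  open Neighbourhood G c4-free
  open Palette σ
  open Palette {n} toℕ using () renaming
    (palette to members; palette-unique to members-unique; ∈palette⁺ to ∈members⁺;
     ∈palette⁻ to ∈members⁻; ∈palette-mono to ∈members-mono; unique⇒length≤coloursUsed to unique⇒length≤size;
     NonEmpty⇒1≤coloursUsed to NonEmpty⇒1≤size)

  -- `toℕ` gives distinct vertices distinct colours, so this counts vertices; it is the measure of
  -- the induction.
  size : VSet n → ℕ
  size = coloursUsed toℕ

  -- For T not m-colourable; at m = χ(T) − 1 the bound reads |σ(S)| − h ≥ χ(T) − 2.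
  record Discrepant (T : VSet n) (m : ℕ) : Set where
    field
      S        : VSet n
      nonEmpty : NonEmpty S
      S⊆T      : ∀ {v} → v ∈ᵥ S → v ∈ᵥ T
      h        : ℕ
      col      : ColourableOn G S h
      bound    : h + m ≤ suc (coloursUsed σ S)

  σ∉palette-N : ∀ T y → σ y ∉ palette (N T y)
  σ∉palette-N T y σy∈ with v , v∈ , eq ← ∈palette⁻ σy∈ = σ-proper _ _ (proj₂ (∈N⁻ v∈)) eq

  abstract
    -- By `σ∉palette-N` the vertex `y` itself would pass the colour test. Leaving it out makes
    -- `size` drop and keeps `y` out of the sets given to `N∪-colourable`.
    rest : VSet n → Fin n → VSet n
    rest T y = ⟪ (λ x → x ∈ᵥ? T ×-dec (¬? (x ≟ᶠ y) ×-dec ¬? (σ x ∈? palette (N T y)))) ⟫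

    ∈rest⁺ : ∀ {T y x} → x ∈ᵥ T → x ≢ y → σ x ∉ palette (N T y) → x ∈ᵥ rest T y
    ∈rest⁺ {T} {y} x∈ x≢y x∉ =
      ∈⟪⟫⁺ (λ x → x ∈ᵥ? T ×-dec (¬? (x ≟ᶠ y) ×-dec ¬? (σ x ∈? palette (N T y)))) (x∈ , x≢y , x∉)

    ∈rest⁻ : ∀ {T y x} → x ∈ᵥ rest T y → x ∈ᵥ T × x ≢ y × σ x ∉ palette (N T y)
    ∈rest⁻ {T} {y} = ∈⟪⟫⁻ (λ x → x ∈ᵥ? T ×-dec (¬? (x ≟ᶠ y) ×-dec ¬? (σ x ∈? palette (N T y))))

  size-rest< : ∀ {T y} → y ∈ᵥ T → size (rest T y) < size T
  size-rest< {T} {y} y∈ = unique⇒length≤size {S = T} (∉⇒unique-∷ y∉ (members-unique (rest T y))) λ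
    { (here refl) → ∈members⁺ y∈
    ; (there x∈)  → ∈members-mono (λ x∈ → proj₁ (∈rest⁻ x∈)) x∈ }
    where
    y∉ : toℕ y ∉ members (rest T y)
    y∉ y∈′ with x , x∈ , eq ← ∈members⁻ y∈′ = proj₁ (proj₂ (∈rest⁻ x∈)) (toℕ-injective (≡-sym eq))

  N∪⊆ : ∀ {T y S} → (∀ {v} → v ∈ᵥ S → v ∈ᵥ rest T y) → ∀ {v} → v ∈ᵥ (N T y ∪ S) → v ∈ᵥ T
  N∪⊆ {T} {y} {S} S⊆ v∈ with ∈∪⁻ v∈
  ... | inj₁ v∈N = proj₁ (∈N⁻ v∈N)
  ... | inj₂ v∈S = proj₁ (∈rest⁻ (S⊆ v∈S))

  N∪-coloursUsed : ∀ {T y S} → (∀ {v} → v ∈ᵥ S → v ∈ᵥ rest T y) →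
    coloursUsed σ (N T y) + coloursUsed σ S ≤ coloursUsed σ (N T y ∪ S)
  N∪-coloursUsed {T} {y} {S} S⊆ = coloursUsed-∪ (N T y) S λ v∈ → proj₂ (proj₂ (∈rest⁻ (S⊆ v∈)))

  -- Adding N(y) costs one colour by `N∪-colourable`, and the colours seen by `y` are all new to
  -- `S`. The bound is the hypothesis with one added on both sides.
  attach-N : ∀ {T y S h m} → (∀ {v} → v ∈ᵥ S → v ∈ᵥ rest T y) → NonEmpty S → ColourableOn G S h →
    h + m ≤ coloursUsed σ (N T y) + coloursUsed σ S → Discrepant T m
  attach-N {h = zero} _ (v , _) (c , _) _ with () ← c v
  attach-N {T} {y} {S} {suc h} {m} S⊆ (x , x∈) col le = record
    { S        = N T y ∪ S
    ; nonEmpty = x , ∈∪⁺ (inj₂ x∈)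
    ; S⊆T      = N∪⊆ S⊆
    ; h        = suc (suc h)
    ; col      = Matching.N∪-colourable T y (λ y∈ → proj₁ (proj₂ (∈rest⁻ (S⊆ y∈))) refl) col
    ; bound    = s≤s (≤-trans le (N∪-coloursUsed S⊆))
    }

  singleton-⊆ : ∀ {x} {T : VSet n} → x ∈ᵥ T → ∀ {v} → v ∈ᵥ singleton x → v ∈ᵥ T
  singleton-⊆ x∈ v∈ with refl ← ∈singleton⁻ v∈ = x∈

  singleton-colourable : ∀ x → ColourableOn G (singleton x) 1
  singleton-colourable x = (λ _ → zero) , λ u v u∈ v∈ e _ →
    ~⇒≢ e (trans (∈singleton⁻ u∈) (≡-sym (∈singleton⁻ v∈)))

  discrepant-singleton : ∀ {T m} → NonEmpty T → m ≤ 1 → Discrepant T m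
  discrepant-singleton (x , x∈) m≤1 = record
    { S        = singleton x
    ; nonEmpty = x , ∈singleton⁺
    ; S⊆T      = singleton-⊆ x∈
    ; h        = 1
    ; col      = singleton-colourable x
    ; bound    = s≤s (≤-trans m≤1 (NonEmpty⇒1≤coloursUsed (x , ∈singleton⁺)))
    }

  -- Two colours suffice for N(y) and `x` together, while `σ x` comes on top of the colours seen by
  -- `y`.
  attach-N-vertex : ∀ {T y x m} → x ∈ᵥ rest T y → m ≤ coloursUsed σ (N T y) → Discrepant T m
  attach-N-vertex {T} {y} {x} {m} x∈ m≤ =
    attach-N {T} {y} (singleton-⊆ x∈) (x , ∈singleton⁺) (singleton-colourable x)
      (≤-trans (s≤s m≤) (≤-trans (≤-reflexive (+-comm 1 _))
        (+-monoʳ-≤ _ (NonEmpty⇒1≤coloursUsed (x , ∈singleton⁺)))))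

  -- Two colours suffice for the matching N(y); this is read off from `N∪-colourable` with the empty
  -- set as a 1-coloured `S`.
  discrepant-N : ∀ {T y m} → m < coloursUsed σ (N T y) → Discrepant T m
  discrepant-N {T} {y} {m} m<a = record
    { S        = N T y ∪ none
    ; nonEmpty = let v , v∈ , _ = ∈palette⁻ {N T y} (∈-lookup (fromℕ< m<a)) in v , ∈∪⁺ (inj₁ v∈)
    ; S⊆T      = N∪⊆ {T} {y} {none} (λ ())
    ; h        = 2
    ; col      = Matching.N∪-colourable T y {none} (λ ()) ((λ _ → zero) , λ _ _ ())
    ; bound    = s≤s (≤-trans (≤-trans m<a (m≤m+n _ _)) (N∪-coloursUsed {T} {y} {none} (λ ())))
    }
    where
    none : VSet n
    none _ = false

  triangle-coloursUsed : ∀ {T} → Triangle T → 3 ≤ coloursUsed σ T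
  triangle-coloursUsed {T} tri = unique⇒length≤coloursUsed {S = T}
    ((σ≢ x₀~x₁ ∷ σ≢ x₀~x₂ ∷ []) ∷ (σ≢ x₁~x₂ ∷ []) ∷ [] ∷ [])
    λ { (here refl) → ∈palette⁺ x₀∈ ; (there (here refl)) → ∈palette⁺ x₁∈
      ; (there (there (here refl))) → ∈palette⁺ x₂∈ }
    where
    open Triangle tri
    σ≢ : ∀ {u v} → u ~ v → σ u ≢ σ v
    σ≢ = σ-proper _ _

  -- The vertices whose colours `y` does not see.

  module _ (T : VSet n) (y : Fin n) where

    private a = coloursUsed σ (N T y)

    -- The four colours of `N∪-colourable` would be one too many against a + 3 colours of `σ`; three
    -- are just enough. The 3-colouring restricts to the triangle, which forces `j` to be 0.
    discrepant-N-triangle : ∀ {j} → Triangle (rest T y) → ¬ ColourableOn G (rest T y) (suc (suc j)) →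
      Discrepant T (a + suc j)
    discrepant-N-triangle {j} tri ¬col = record
      { S        = N T y ∪ rest T y
      ; nonEmpty = x₀ , ∈∪⁺ (inj₂ x₀∈)
      ; S⊆T      = N∪⊆ {T} {y} (λ v∈ → v∈)
      ; h        = 3
      ; col      = col
      ; bound    = s≤s (begin
          2 + (a + suc j)                    ≤⟨ +-monoʳ-≤ 2 (+-monoʳ-≤ a 1+j≤1) ⟩
          2 + (a + 1)                        ≡⟨ +-comm 2 (a + 1) ⟩
          (a + 1) + 2                        ≡⟨ +-assoc a 1 2 ⟩
          a + 3                              ≤⟨ +-monoʳ-≤ a (triangle-coloursUsed tri) ⟩
          a + coloursUsed σ (rest T y)       ≤⟨ N∪-coloursUsed {T} {y} (λ v∈ → v∈) ⟩
          coloursUsed σ (N T y ∪ rest T y)   ∎)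
      }
      where
      open Triangle tri
      open ≤-Reasoning

      col : ColourableOn G (N T y ∪ rest T y) 3
      col = Matching.N∪triangle-colourable T y
        (λ v∈ v∈N → proj₂ (proj₂ (∈rest⁻ v∈)) (∈palette⁺ v∈N)) tri

      1+j≤1 : suc j ≤ 1
      1+j≤1 = ≤-pred (≤-pred (≰⇒> λ 3≤ → ¬col (colourable-mono 3≤
        (colourable-⊆ (λ v∈ → ∈∪⁺ (inj₂ v∈)) col))))

    -- y can share a colour with the rest, since it has no neighbours there.
    module Extension {j : ℕ} (τ : Fin n → Fin (suc j)) where

      paint : ∀ {v} → Dec (σ v ∈ palette (N T y)) → Dec (v ≡ y) → Fin (a + suc j)
      paint     (yes p) _       = index p ↑ˡ suc j
      paint     (no _)  (yes _) = a ↑ʳ zero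
      paint {v} (no _)  (no _)  = a ↑ʳ τ v

      κ : Fin n → Fin (a + suc j)
      κ v = paint {v} (σ v ∈? palette (N T y)) (v ≟ᶠ y)

      data View (v : Fin n) (i : Fin (a + suc j)) : Set where
        seen   : (p : σ v ∈ palette (N T y)) → i ≡ index p ↑ˡ suc j → View v i
        centre : v ≡ y → i ≡ a ↑ʳ zero → View v i
        other  : v ≢ y → σ v ∉ palette (N T y) → i ≡ a ↑ʳ τ v → View v i

      view : ∀ v → View v (κ v)
      view v with σ v ∈? palette (N T y) | v ≟ᶠ y
      ... | yes p | _       = seen p refl
      ... | no _  | yes v≡y = centre v≡y refl
      ... | no v∉ | no v≢y  = other v≢y v∉ refl

      ↑ˡ≢↑ʳ : ∀ {i : Fin a} {k : Fin (suc j)} → i ↑ˡ suc j ≢ a ↑ʳ k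
      ↑ˡ≢↑ʳ {i} {k} eq
        with () ← trans (≡-sym (splitAt-↑ˡ a i (suc j))) (trans (cong (splitAt a) eq) (splitAt-↑ʳ a (suc j) k))

      clash : ∀ {u v i k} → u ∈ᵥ T → v ∈ᵥ T → (u ∈ᵥ rest T y → v ∈ᵥ rest T y → τ u ≢ τ v) →
        View u i → View v k → u ~ v → i ≢ k
      clash u∈ v∈ _ (seen p refl) (seen q refl) e eq =
        σ-proper _ _ e (index-injective p q (↑ˡ-injective (suc j) _ _ eq))
      clash u∈ v∈ _ (seen _ refl) (centre _ refl)  e eq = ↑ˡ≢↑ʳ eq
      clash u∈ v∈ _ (seen _ refl) (other _ _ refl) e eq = ↑ˡ≢↑ʳ eq
      clash u∈ v∈ _ (centre _ refl)  (seen _ refl) e eq = ↑ˡ≢↑ʳ (≡-sym eq)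
      clash u∈ v∈ _ (other _ _ refl) (seen _ refl) e eq = ↑ˡ≢↑ʳ (≡-sym eq)
      clash u∈ v∈ _ (centre refl _) (centre refl _) e _ = ~⇒≢ e refl
      clash u∈ v∈ _ (centre refl _) (other _ v∉ _) e _ = v∉ (∈palette⁺ (∈N⁺ v∈ e))
      clash u∈ v∈ _ (other _ u∉ _) (centre refl _) e _ = u∉ (∈palette⁺ (∈N⁺ u∈ (~-sym e)))
      clash u∈ v∈ τ≢ (other u≢y u∉ refl) (other v≢y v∉ refl) e eq =
        τ≢ (∈rest⁺ u∈ u≢y u∉) (∈rest⁺ v∈ v≢y v∉) (↑ʳ-injective a _ _ eq)

      κ-proper : ∀ {u v} → u ∈ᵥ T → v ∈ᵥ T → (u ∈ᵥ rest T y → v ∈ᵥ rest T y → τ u ≢ τ v) → u ~ v → κ u ≢ κ v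
      κ-proper u∈ v∈ τ≢ = clash u∈ v∈ τ≢ (view _) (view _)

      σ-of-seen : ∀ {v c} (p : c ∈ palette (N T y)) → κ v ≡ index p ↑ˡ suc j → c ≡ σ v
      σ-of-seen {v} p eq with view v
      ... | seen q eq′      = index-injective p q (↑ˡ-injective (suc j) _ _ (trans (≡-sym eq) eq′))
      ... | centre _ eq′    = contradiction (trans (≡-sym eq) eq′) ↑ˡ≢↑ʳ
      ... | other _ _ eq′   = contradiction (trans (≡-sym eq) eq′) ↑ˡ≢↑ʳ

      σ-of-unseen : ∀ {v k} → κ v ≡ a ↑ʳ k → σ v ∉ palette (N T y)
      σ-of-unseen {v} eq with view v
      ... | seen _ eq′    = contradiction (trans (≡-sym eq′) eq) ↑ˡ≢↑ʳ
      ... | centre refl _ = σ∉palette-N T y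
      ... | other _ v∉ _  = v∉

    rest-¬colourable : ∀ {j} → ¬ ColourableOn G T (a + suc j) → ¬ ColourableOn G (rest T y) (suc j)
    rest-¬colourable ¬col (τ , proper) = ¬col
      (κ , λ u v u∈ v∈ e → κ-proper u∈ v∈ (λ u∈′ v∈′ → proper u v u∈′ v∈′ e) e)
      where open Extension τ

    -- Otherwise a vertex of one colour class of the rest sees all colours seen by y, and another one.
    rest-¬colourable⁺ : (∀ {z} → z ∈ᵥ T → coloursUsed σ (N T z) ≤ a) →
      ∀ {j} → ¬ ColourableOn G T (a + suc j) → ¬ ColourableOn G (rest T y) (suc (suc j))
    rest-¬colourable⁺ maximal {j} ¬col (τ , proper) =
      let z , z∈ , _ , saturated = saturatedVertex T X (a + suc j) κ κ-proper′ independent ¬col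
      in <-irrefl refl (≤-trans (a<N z saturated) (maximal z∈))
      where
      -- Merging colours 0 and 1 of `τ` saves one colour and spoils only edges at class 0. That
      -- class is `X`, which `saturatedVertex` exempts.
      lower : Fin (suc (suc j)) → Fin (suc j)
      lower zero    = zero
      lower (suc i) = i

      lower-injective : ∀ {i k} → i ≢ zero → k ≢ zero → lower i ≡ lower k → i ≡ k
      lower-injective {zero}          i≢0 _   _  = contradiction refl i≢0
      lower-injective {suc _} {zero}  _   k≢0 _  = contradiction refl k≢0
      lower-injective {suc _} {suc _} _   _   eq = cong suc eq

      open Extension (lower ∘ τ)

      X? : ∀ v → Dec (v ∈ᵥ rest T y × τ v ≡ zero)
      X? v = v ∈ᵥ? rest T y ×-dec τ v ≟ᶠ zero

      X : VSet n
      X = ⟪ X? ⟫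

      κ-proper′ : ∀ u v → u ∈ᵥ T → v ∈ᵥ T → ¬ u ∈ᵥ X → ¬ v ∈ᵥ X → u ~ v → κ u ≢ κ v
      κ-proper′ u v u∈ v∈ u∉X v∉X e = κ-proper u∈ v∈ (λ u∈′ v∈′ eq → proper u v u∈′ v∈′ e
        (lower-injective (λ τu → u∉X (∈⟪⟫⁺ X? (u∈′ , τu))) (λ τv → v∉X (∈⟪⟫⁺ X? (v∈′ , τv))) eq)) e

      independent : ∀ u v → u ∈ᵥ X → v ∈ᵥ X → ¬ u ~ v
      independent u v u∈ v∈ e with u∈′ , τu ← ∈⟪⟫⁻ X? u∈ | v∈′ , τv ← ∈⟪⟫⁻ X? v∈ =
        proper u v u∈′ v∈′ e (trans τu (≡-sym τv))

      -- Saturation at the palette indices yields every colour seen by `y`; at `a ↑ʳ zero` it yields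
      -- a neighbour whose colour `y` does not see.
      a<N : ∀ z → (∀ i → ∃ λ v → v ∈ᵥ T × ¬ v ∈ᵥ X × z ~ v × κ v ≡ i) → a < coloursUsed σ (N T z)
      a<N z saturated with w , w∈ , _ , zw , κw ← saturated (a ↑ʳ zero) =
        unique⇒length≤coloursUsed {S = N T z} (∉⇒unique-∷ (σ-of-unseen κw) (palette-unique (N T y)))
          λ { (here refl) → ∈palette⁺ (∈N⁺ w∈ zw) ; (there c∈) → seen-by-z c∈ }
        where
        seen-by-z : ∀ {c} → c ∈ palette (N T y) → c ∈ palette (N T z)
        seen-by-z c∈ with v , v∈ , _ , zv , κv ← saturated (index c∈ ↑ˡ suc j)
                     with refl ← σ-of-seen c∈ κv = ∈palette⁺ (∈N⁺ v∈ zv)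

  -- One or two vertices could be coloured with two colours. A fourth vertex would, like `u`, be a
  -- common neighbour of `y` and `v`.
  clique⇒triangle : ∀ {T y m} → y ∈ᵥ T → (∀ {u v} → u ∈ᵥ T → v ∈ᵥ T → u ≢ v → u ~ v) →
    ¬ ColourableOn G T (suc (suc m)) → Triangle T
  clique⇒triangle {T} {y} {m} y∈ complete ¬col
    with any? (λ u → u ∈ᵥ? T ×-dec ¬? (u ≟ᶠ y))
  ... | no none = ⊥-elim (¬col ((λ _ → zero) , λ u v u∈ v∈ e _ → ~⇒≢ e (trans (is-y u∈) (≡-sym (is-y v∈)))))
    where
    is-y : ∀ {u} → u ∈ᵥ T → u ≡ y
    is-y {u} u∈ = decidable-stable (u ≟ᶠ y) λ u≢y → none (u , u∈ , u≢y)
  ... | yes (u , u∈ , u≢y) with any? (λ v → v ∈ᵥ? T ×-dec (¬? (v ≟ᶠ y) ×-dec ¬? (v ≟ᶠ u)))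
  ...   | no none = ⊥-elim (¬col (κ , proper))
    where
    κ : Fin n → Fin (suc (suc m))
    κ v with v ≟ᶠ y
    ... | yes _ = zero
    ... | no _  = suc zero

    is-u : ∀ {v} → v ∈ᵥ T → v ≢ y → v ≡ u
    is-u {v} v∈ v≢y = decidable-stable (v ≟ᶠ u) λ v≢u → none (v , v∈ , v≢y , v≢u)

    proper : ∀ v w → v ∈ᵥ T → w ∈ᵥ T → v ~ w → κ v ≢ κ w
    proper v w v∈ w∈ e eq with v ≟ᶠ y | w ≟ᶠ y
    ... | yes v≡y | yes w≡y = ~⇒≢ e (trans v≡y (≡-sym w≡y))
    ... | no v≢y  | no w≢y  = ~⇒≢ e (trans (is-u v∈ v≢y) (≡-sym (is-u w∈ w≢y)))
    proper v w v∈ w∈ e () | yes _ | no _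
    proper v w v∈ w∈ e () | no _  | yes _
  ...   | yes (v , v∈ , v≢y , v≢u) = record
    { x₀∈ = y∈ ; x₁∈ = u∈ ; x₂∈ = v∈
    ; x₀~x₁ = complete y∈ u∈ (≢-sym u≢y)
    ; x₁~x₂ = complete u∈ v∈ (≢-sym v≢u)
    ; x₀~x₂ = complete y∈ v∈ (≢-sym v≢y)
    ; exhaustive = exhaustive
    }
    where
    exhaustive : ∀ {w} → w ∈ᵥ T → w ≡ y ⊎ w ≡ u ⊎ w ≡ v
    exhaustive {w} w∈ with w ≟ᶠ y | w ≟ᶠ u | w ≟ᶠ v
    ... | yes w≡y | _       | _       = inj₁ w≡y
    ... | no _    | yes w≡u | _       = inj₂ (inj₁ w≡u)
    ... | no _    | no _    | yes w≡v = inj₂ (inj₂ w≡v)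
    ... | no w≢y  | no w≢u  | no w≢v  = contradiction
      (commonNbr-unique (≢-sym v≢y) (complete y∈ u∈ (≢-sym u≢y)) (complete v∈ u∈ v≢u)
                        (complete y∈ w∈ (≢-sym w≢y)) (complete v∈ w∈ (≢-sym w≢v)))
      (≢-sym w≢u)

  -- The case of an empty rest.

  module RestEmpty (T : VSet n) (y : Fin n) (empty : ∀ x → ¬ x ∈ᵥ rest T y)
                   {m : ℕ} (a≡2+m : coloursUsed σ (N T y) ≡ suc (suc m)) (¬col : ¬ ColourableOn G T (suc (suc m))) where

    other? : ∀ c v → Dec (v ∈ᵥ T × σ v ≢ c)
    other? c v = v ∈ᵥ? T ×-dec ¬? (σ v ≟ c)

    others : ℕ → VSet n
    others c = ⟪ other? c ⟫

    σ∈ : ∀ {v} → v ∈ᵥ T → σ v ∈ σ y ∷ palette (N T y)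
    σ∈ {v} v∈ with σ v ∈? palette (N T y) | v ≟ᶠ y
    ... | yes σv∈ | _        = there σv∈
    ... | no _    | yes refl = here refl
    ... | no σv∉  | no v≢y   = contradiction (∈rest⁺ v∈ v≢y σv∉) (empty v)

    -- Every colour on `T` is `σ y` or one of the m + 2 that `y` sees, and `σ x` is dropped from
    -- these m + 3.
    coloursUsed-others : ∀ {x} → x ∈ᵥ T → coloursUsed σ (others (σ x)) ≤ suc (suc m)
    coloursUsed-others {x} x∈ = subst (coloursUsed σ (others (σ x)) ≤_) a≡2+m (≤-pred
      (unique-⊆⇒length≤ (∉⇒unique-∷ σx∉ (palette-unique (others (σ x)))) sub))
      where
      σx∉ : σ x ∉ palette (others (σ x))
      σx∉ σx∈ with v , v∈ , eq ← ∈palette⁻ σx∈ = proj₂ (∈⟪⟫⁻ (other? (σ x)) v∈) (≡-sym eq)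

      sub : ∀ {c} → c ∈ σ x ∷ palette (others (σ x)) → c ∈ σ y ∷ palette (N T y)
      sub (here refl) = σ∈ x∈
      sub (there c∈) with v , v∈ , refl ← ∈palette⁻ c∈ = σ∈ (proj₁ (∈⟪⟫⁻ (other? (σ x)) v∈))

    -- In the theory of b-colourings this is a b-vertex of class `c`; `sees-many` records the count
    -- in the form that `attach-N-vertex` takes.
    record ColourfulVertex (c : ℕ) : Set where
      field
        z         : Fin n
        z∈        : z ∈ᵥ T
        σz        : σ z ≡ c
        sees      : ∀ {v} → v ∈ᵥ T → σ v ≢ c → ∃ λ w → w ∈ᵥ T × z ~ w × σ w ≡ σ v
        sees-many : suc (suc m) ≤ coloursUsed σ (N T z)

    -- Apply `saturatedVertex` to the class of `x`: without a colourful vertex the class could be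
    -- dissolved into the others, which carry at most m + 2 colours.
    colourfulVertex : ∀ {x} → x ∈ᵥ T → ColourfulVertex (σ x)
    colourfulVertex {x} x∈ =
      let z , z∈ , z∈X , saturated = saturatedVertex T X (suc (suc m)) (κ ∘ σ) proper independent ¬col
          seen : Fin (suc (suc m)) → Fin (coloursUsed σ (N T z))
          seen i = let _ , v∈ , _ , zv , _ = saturated i in index (∈palette⁺ {N T z} (∈N⁺ v∈ zv))
      in record
        { z         = z
        ; z∈        = z∈
        ; σz        = ∈⟪⟫⁻ X? z∈X
        ; sees      = λ {v} v∈ σv≢ → let w , w∈ , w∉X , zw , κw = saturated (κ (σ v)) in
            w , w∈ , zw , κ-injective (σ∈others w∈ (λ eq → w∉X (∈⟪⟫⁺ X? eq))) (σ∈others v∈ σv≢) κw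
        -- Neighbours chosen for distinct indices differ in `κ ∘ σ`, hence in `σ`.
        ; sees-many = injective⇒≤ {f = seen} λ {i} {j} eq →
            let u , u∈ , _ , zu , κu = saturated i
                v , v∈ , _ , zv , κv = saturated j
            in trans (≡-sym κu) (trans
                 (cong κ (index-injective (∈palette⁺ {N T z} (∈N⁺ u∈ zu)) (∈palette⁺ {N T z} (∈N⁺ v∈ zv)) eq)) κv)
        }
      where
      X? : ∀ v → Dec (σ v ≡ σ x)
      X? v = σ v ≟ σ x

      X : VSet n
      X = ⟪ X? ⟫

      rank : ∀ {c} → Dec (c ∈ palette (others (σ x))) → Fin (suc (suc m))
      rank (yes p) = inject≤ (index p) (coloursUsed-others x∈)
      -- A default: `κ` has to be injective only on the palette of `others (σ x)`.
      rank (no _)  = zero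

      κ : ℕ → Fin (suc (suc m))
      κ c = rank (c ∈? palette (others (σ x)))

      κ-injective : ∀ {c d} → c ∈ palette (others (σ x)) → d ∈ palette (others (σ x)) → κ c ≡ κ d → c ≡ d
      κ-injective {c} {d} c∈ d∈ eq with c ∈? palette (others (σ x)) | d ∈? palette (others (σ x))
      ... | yes p | yes q = index-injective p q (inject≤-injective _ _ _ _ eq)
      ... | no c∉ | _     = contradiction c∈ c∉
      ... | yes _ | no d∉ = contradiction d∈ d∉

      σ∈others : ∀ {v} → v ∈ᵥ T → σ v ≢ σ x → σ v ∈ palette (others (σ x))
      σ∈others v∈ σv≢ = ∈palette⁺ (∈⟪⟫⁺ (other? (σ x)) (v∈ , σv≢))

      proper : ∀ u v → u ∈ᵥ T → v ∈ᵥ T → ¬ u ∈ᵥ X → ¬ v ∈ᵥ X → u ~ v → κ (σ u) ≢ κ (σ v)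
      proper u v u∈ v∈ u∉X v∉X e eq = σ-proper u v e
        (κ-injective (σ∈others u∈ (u∉X ∘ ∈⟪⟫⁺ X?)) (σ∈others v∈ (v∉X ∘ ∈⟪⟫⁺ X?)) eq)

      independent : ∀ u v → u ∈ᵥ X → v ∈ᵥ X → ¬ u ~ v
      independent u v u∈ v∈ e = σ-proper u v e (trans (∈⟪⟫⁻ X? u∈) (≡-sym (∈⟪⟫⁻ X? v∈)))

    -- One of `u` and `v` differs from the colourful vertex `z` of their class. It has the colour of
    -- `z`, which `z` cannot see, so it lies in `rest T z`.
    discrepant-repeated : ∀ {u v} → u ∈ᵥ T → v ∈ᵥ T → u ≢ v → σ u ≡ σ v → Discrepant T (suc (suc m))
    discrepant-repeated {u} {v} u∈ v∈ u≢v σu≡σv with colourfulVertex u∈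
    ... | record { z = z ; z∈ = z∈ ; σz = σz ; sees-many = sees-many } with u ≟ᶠ z
    ...   | yes refl = attach-N-vertex
      (∈rest⁺ v∈ (≢-sym u≢v) (subst (_∉ palette (N T z)) σu≡σv (σ∉palette-N T z))) sees-many
    ...   | no u≢z   = attach-N-vertex
      (∈rest⁺ u∈ u≢z (subst (_∉ palette (N T z)) σz (σ∉palette-N T z))) sees-many

    -- The colourful vertex of the class of `u` can only be `u`, and its neighbour coloured `σ v`
    -- can only be `v`.
    clique : (∀ {u v} → u ∈ᵥ T → v ∈ᵥ T → σ u ≡ σ v → u ≡ v) → ∀ {u v} → u ∈ᵥ T → v ∈ᵥ T → u ≢ v → u ~ v
    clique injective {u} {v} u∈ v∈ u≢v =
      let open ColourfulVertex (colourfulVertex u∈)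
          w , w∈ , zw , σw = sees v∈ (λ eq → u≢v (≡-sym (injective v∈ u∈ eq)))
      in subst (_~ v) (injective z∈ u∈ σz) (subst (z ~_) (injective w∈ v∈ σw) zw)

    discrepant⊎triangle : y ∈ᵥ T → Discrepant T (suc (suc m)) ⊎ Triangle T
    discrepant⊎triangle y∈
      with any? (λ u → any? λ v → u ∈ᵥ? T ×-dec (v ∈ᵥ? T ×-dec (¬? (u ≟ᶠ v) ×-dec σ u ≟ σ v)))
    ... | yes (u , v , u∈ , v∈ , u≢v , eq) = inj₁ (discrepant-repeated u∈ v∈ u≢v eq)
    ... | no none = inj₂ (clique⇒triangle y∈ (clique λ {u} {v} u∈ v∈ eq →
      decidable-stable (u ≟ᶠ v) λ u≢v → none (u , v , u∈ , v∈ , u≢v , eq)) ¬col)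

  -- The induction.

  maximalNbrs : ∀ T → NonEmpty T → ∃ λ y → y ∈ᵥ T × (∀ {z} → z ∈ᵥ T → coloursUsed σ (N T z) ≤ coloursUsed σ (N T y))
  maximalNbrs T (v , v∈) =
    argmax f v xs , argmax-all f v∈ (All.tabulate λ x∈ → proj₂ (∈-filter⁻ (_∈ᵥ? T) {xs = allFin n} x∈)) ,
    λ {z} z∈ → All.lookup (f[xs]≤f[argmax] v xs) (∈-filter⁺ (_∈ᵥ? T) (∈-allFin z) z∈)
    where
    f : Fin n → ℕ
    f z = coloursUsed σ (N T z)

    xs : List (Fin n)
    xs = filter (_∈ᵥ? T) (allFin n)

  -- `T` and `m` vary so that the induction applies to `rest T y`; the bound `s` makes the recursion
  -- structural.
  discrepant-or-triangle : ∀ s T → size T ≤ s → NonEmpty T → ∀ m → ¬ ColourableOn G T m →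
    Discrepant T m ⊎ Triangle T
  discrepant-or-triangle zero    T |T|≤0 ne m _ = contradiction (≤-trans (NonEmpty⇒1≤size {T} ne) |T|≤0) λ ()
  -- For m ≤ 1 one vertex is enough. Having m ≥ 2 afterwards excludes cliques on one or two vertices
  -- when the rest is empty.
  discrepant-or-triangle (suc s) T |T|≤ ne zero       _ = inj₁ (discrepant-singleton ne z≤n)
  discrepant-or-triangle (suc s) T |T|≤ ne (suc zero) _ = inj₁ (discrepant-singleton ne ≤-refl)
  discrepant-or-triangle (suc s) T |T|≤ ne m@(suc (suc _)) ¬col
    with y , y∈ , maximal ← maximalNbrs T ne
    with <-cmp m (coloursUsed σ (N T y)) | any? (_∈ᵥ? rest T y)
  ... | tri< m<a _ _ | _            = inj₁ (discrepant-N {y = y} m<a)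
  ... | tri≈ _ m≡a _ | yes (x , x∈) = inj₁ (attach-N-vertex x∈ (≤-reflexive m≡a))
  ... | tri≈ _ m≡a _ | no empty     =
    RestEmpty.discrepant⊎triangle T y (λ x x∈ → empty (x , x∈)) (≡-sym m≡a) ¬col y∈
  ... | tri> _ _ a<m | rest-empty?  with j , eq ← m≤n⇒∃[o]m+o≡n a<m =
    inj₁ (subst (Discrepant T) a+1+j≡m (beyond rest-empty? (subst (¬_ ∘ ColourableOn G T) (≡-sym a+1+j≡m) ¬col)))
    where
    a = coloursUsed σ (N T y)

    a+1+j≡m : a + suc j ≡ m
    a+1+j≡m = trans (+-suc a j) eq

    beyond : Dec (NonEmpty (rest T y)) → ¬ ColourableOn G T (a + suc j) → Discrepant T (a + suc j)
    -- An empty rest can be coloured with any positive number of colours.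
    beyond (no empty) ¬col′ = contradiction
      ((λ _ → zero) , λ u _ u∈ → contradiction (u , u∈) empty) (rest-¬colourable T y ¬col′)
    beyond (yes ne′) ¬col′
      with discrepant-or-triangle s (rest T y) (≤-pred (≤-trans (size-rest< y∈) |T|≤)) ne′
             (suc (suc j)) (rest-¬colourable⁺ T y maximal ¬col′)
    ... | inj₂ tri = discrepant-N-triangle T y tri (rest-¬colourable⁺ T y maximal ¬col′)
    -- The recursion ran with `suc (suc j)` although m - a is `suc j`; the surplus pays for the
    -- colour that adding N(y) costs.
    ... | inj₁ record { S = S ; nonEmpty = nonEmpty ; S⊆T = S⊆ ; h = h ; col = col ; bound = bound } =
      attach-N S⊆ nonEmpty col (begin
        h + (a + suc j)       ≡⟨ +-comm h (a + suc j) ⟩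
        (a + suc j) + h       ≡⟨ +-assoc a (suc j) h ⟩
        a + (suc j + h)       ≡⟨ cong (a +_) (+-comm (suc j) h) ⟩
        a + (h + suc j)       ≤⟨ +-monoʳ-≤ a (≤-pred (subst (_≤ suc (coloursUsed σ S)) (+-suc h (suc j)) bound)) ⟩
        a + coloursUsed σ S   ∎)
      where open ≤-Reasoning

-- The exceptional graph K₃, and the theorem.

triangle⇒K₃ : ∀ {n} (G : Graph n) → Colouring.Triangle G full → Iso G K3
triangle⇒K₃ {n} G tri = mk⤖ {to = to} (to-injective , to-surjective) , λ u v → adjacent (view u) (view v)
  where
  open Colouring G
  open Triangle tri

  data View (v : Fin n) : Fin 3 → Set where
    is-x₀ : v ≡ x₀ → View v zero
    is-x₁ : v ≡ x₁ → View v (suc zero)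
    is-x₂ : v ≡ x₂ → View v (suc (suc zero))

  view′ : ∀ v → ∃ (View v)
  view′ v with exhaustive {v} refl
  ... | inj₁ eq        = zero , is-x₀ eq
  ... | inj₂ (inj₁ eq) = suc zero , is-x₁ eq
  ... | inj₂ (inj₂ eq) = suc (suc zero) , is-x₂ eq

  to : Fin n → Fin 3
  to v = proj₁ (view′ v)

  view : ∀ v → View v (to v)
  view v = proj₂ (view′ v)

  view-injective : ∀ {u v i j} → View u i → View v j → i ≡ j → u ≡ v
  view-injective (is-x₀ refl) (is-x₀ refl) _ = refl
  view-injective (is-x₁ refl) (is-x₁ refl) _ = refl
  view-injective (is-x₂ refl) (is-x₂ refl) _ = refl

  view-functional : ∀ {u i j} → View u i → View u j → i ≡ j
  view-functional (is-x₀ refl) (is-x₀ _)  = refl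
  view-functional (is-x₁ refl) (is-x₁ _)  = refl
  view-functional (is-x₂ refl) (is-x₂ _)  = refl
  view-functional (is-x₀ refl) (is-x₁ eq) = contradiction eq (~⇒≢ x₀~x₁)
  view-functional (is-x₀ refl) (is-x₂ eq) = contradiction eq (~⇒≢ x₀~x₂)
  view-functional (is-x₁ refl) (is-x₂ eq) = contradiction eq (~⇒≢ x₁~x₂)
  view-functional (is-x₁ refl) (is-x₀ eq) = contradiction (≡-sym eq) (~⇒≢ x₀~x₁)
  view-functional (is-x₂ refl) (is-x₀ eq) = contradiction (≡-sym eq) (~⇒≢ x₀~x₂)
  view-functional (is-x₂ refl) (is-x₁ eq) = contradiction (≡-sym eq) (~⇒≢ x₁~x₂)

  to-injective : ∀ {u v} → to u ≡ to v → u ≡ v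
  to-injective {u} {v} = view-injective (view u) (view v)

  preimage : ∀ i → ∃ λ v → View v i
  preimage zero             = x₀ , is-x₀ refl
  preimage (suc zero)       = x₁ , is-x₁ refl
  preimage (suc (suc zero)) = x₂ , is-x₂ refl

  to-surjective : ∀ i → ∃ λ v → ∀ {u} → u ≡ v → to u ≡ i
  to-surjective i = let v , p = preimage i in v , λ { refl → view-functional (view v) p }

  adjacent : ∀ {u v i j} → View u i → View v j → adj G u v ≡ adj K3 i j
  adjacent (is-x₀ refl) (is-x₀ refl) = irrefl G _
  adjacent (is-x₁ refl) (is-x₁ refl) = irrefl G _
  adjacent (is-x₂ refl) (is-x₂ refl) = irrefl G _
  adjacent (is-x₀ refl) (is-x₁ refl) = x₀~x₁
  adjacent (is-x₀ refl) (is-x₂ refl) = x₀~x₂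
  adjacent (is-x₁ refl) (is-x₂ refl) = x₁~x₂
  adjacent (is-x₁ refl) (is-x₀ refl) = ~-sym x₀~x₁
  adjacent (is-x₂ refl) (is-x₀ refl) = ~-sym x₀~x₂
  adjacent (is-x₂ refl) (is-x₁ refl) = ~-sym x₁~x₂

theorem1p10 : (n : ℕ) (G : Graph (suc n)) → C4Free G → ¬ Iso G K3 →
    (k : ℕ) → IsChromatic G k →
    (σ : Fin (suc n) → ℕ) → ProperColouring G σ →
    Σ (VSet (suc n)) λ S → NonEmpty S × Σ ℕ λ h → IsChromaticOn G S h ×
    h + k ≤ coloursUsed σ S + 2
theorem1p10 n G c4-free ¬K₃ zero    ((c , _) , _) σ σ-proper with () ← c zero
-- With m = k - 1, minimality of k says that `G` is not m-colourable, and h + m ≤ |σ(S)| + 1 is the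
-- claimed bound lowered by one.
theorem1p10 n G c4-free ¬K₃ (suc m) (_ , minimal) σ σ-proper
  with Discrepancy.discrepant-or-triangle G c4-free σ σ-proper _ full ≤-refl (zero , refl) m (minimal m ≤-refl)
... | inj₂ tri = contradiction (triangle⇒K₃ G tri) ¬K₃
... | inj₁ d   =
  let h′ , chromatic , h′≤h = Colouring.chromatic-≤ G S h col
  in S , nonEmpty , h′ , chromatic , (begin
    h′ + suc m              ≤⟨ +-monoˡ-≤ (suc m) h′≤h ⟩
    h + suc m               ≡⟨ +-suc h m ⟩
    suc (h + m)             ≤⟨ s≤s bound ⟩
    2 + coloursUsed σ S     ≡⟨ +-comm 2 _ ⟩
    coloursUsed σ S + 2     ∎)
  where
  open Discrepancy.Discrepant d
  open ≤-Reasoning
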